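{- Let $G=(X,Y;E)$ be a bipartite graph with $n$ vertices and let $M\subseteq E$ be a matching of $G$. Then $M$ is a perfect matching of $G$ that is uniquely restricted if and only if the $BD$-mapping digraph $D(G,M)$ is acyclic and has exactly $n/2$ vertices.
   Context: A matching $M$ is uniquely restricted if the subgraph of $G$ induced by the vertices saturated by $M$ has a unique perfect matching (namely $M$). For each edge of $M$ write it as $(x,x')$ with $x\in X$, $x'\in Y$; $x'$ is called the partner of $x$. The $BD$-mapping digraph $D(G,M)=(V,A)$ has vertex set $V=\{x\in X : (x,x')\in M \text{ for some } x'\}$ and arc set $A=\{\langle x_1,x_2\rangle : x_1,x_2\in V,\ (x_1,x_2')\in E\setminus M\}$, where $x_2'$ is the partner of $x_2$. $|D(G,M)|$ denotes the number of vertices of $D(G,M)$. -}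

module Defs where

open import Level using (0ℓ)
open import Data.Nat using (ℕ; suc; _+_)
open import Data.Fin using (Fin; zero; suc; inject₁; fromℕ)
open import Data.Fin.Properties using (any?)
open import Data.Fin.Subset using (Subset; _∈_; _∩_; ∣_∣)
open import Data.Fin.Subset.Properties using (_∈?_; x∈p∩q⁺)
open import Data.Vec using (tabulate)
open import Data.Product using (_×_; _,_; ∃-syntax)
open import Function using (_∘_; _⇔_)
open import Function.Definitions using (Injective)
open import Relation.Binary using (Rel; REL)
open import Relation.Binary.Definitions using (Decidable)
open import Relation.Binary.PropositionalEquality using (_≡_)
open import Relation.Nullary using (¬_; does)
open import Relation.Nullary.Decidable using (_×-dec_)
import Relation.Unary as U

subset : ∀ {n} {P : U.Pred (Fin n) 0ℓ} → U.Decidable P → Subset n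
subset P? = tabulate (does ∘ P?)

record EdgeSet (a b : ℕ) : Set₁ where
  field
    _─_  : REL (Fin a) (Fin b) 0ℓ
    _─?_ : Decidable _─_

infix 4 _∋_─_ _⊆ᴱ_ _≐ᴱ_

_∋_─_ : ∀ {a b} → EdgeSet a b → Fin a → Fin b → Set
F ∋ x ─ y = EdgeSet._─_ F x y

_⊆ᴱ_ _≐ᴱ_ : ∀ {a b} → EdgeSet a b → EdgeSet a b → Set
F ⊆ᴱ F′ = ∀ {x y} → F ∋ x ─ y → F′ ∋ x ─ y
F ≐ᴱ F′ = ∀ x y → F ∋ x ─ y ⇔ F′ ∋ x ─ y

-- The two colour classes are arbitrary subsets of the disjoint ambient sets
-- Fin a and Fin b, so that induced subgraphs are again bipartite graphs over
-- the same ambient sets.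
record BipartiteGraph (a b : ℕ) : Set₁ where
  field
    X     : Subset a
    Y     : Subset b
    E     : EdgeSet a b
    E⊆X×Y : ∀ {x y} → E ∋ x ─ y → x ∈ X × y ∈ Y

  order : ℕ
  order = ∣ X ∣ + ∣ Y ∣

module _ {a b : ℕ} where

  induced : BipartiteGraph a b → Subset a → Subset b → BipartiteGraph a b
  induced G S T = record
    { X     = X ∩ S
    ; Y     = Y ∩ T
    ; E     = record
      { _─_  = λ x y → E ∋ x ─ y × x ∈ S × y ∈ T
      ; _─?_ = λ x y → (x ─? y) ×-dec ((x ∈? S) ×-dec (y ∈? T))
      }
    ; E⊆X×Y = λ { (e , x∈S , y∈T) → let (x∈X , y∈Y) = E⊆X×Y e in
                  x∈p∩q⁺ (x∈X , x∈S) , x∈p∩q⁺ (y∈Y , y∈T) }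
    }
    where
    open BipartiteGraph G
    open EdgeSet E using (_─?_)

  record IsMatching (G : BipartiteGraph a b) (M : EdgeSet a b) : Set where
    open BipartiteGraph G
    field
      M⊆E     : M ⊆ᴱ E
      uniqueʸ : ∀ {x y y′} → M ∋ x ─ y → M ∋ x ─ y′ → y ≡ y′
      uniqueˣ : ∀ {x x′ y} → M ∋ x ─ y → M ∋ x′ ─ y → x ≡ x′

  record IsPerfectMatching (G : BipartiteGraph a b) (M : EdgeSet a b) : Set where
    open BipartiteGraph G
    field
      isMatching : IsMatching G M
      saturatesX : ∀ {x} → x ∈ X → ∃[ y ] M ∋ x ─ y
      saturatesY : ∀ {y} → y ∈ Y → ∃[ x ] M ∋ x ─ y

  saturatedX : BipartiteGraph a b → EdgeSet a b → Subset a
  saturatedX G M = subset λ x → (x ∈? X) ×-dec any? λ y → x ─? y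
    where
    open BipartiteGraph G
    open EdgeSet M using (_─?_)

  saturatedY : BipartiteGraph a b → EdgeSet a b → Subset b
  saturatedY G M = subset λ y → (y ∈? Y) ×-dec any? λ x → x ─? y
    where
    open BipartiteGraph G
    open EdgeSet M using (_─?_)

  IsUniquePerfectMatching : BipartiteGraph a b → EdgeSet a b → Set₁
  IsUniquePerfectMatching G M =
    IsPerfectMatching G M × (∀ N → IsPerfectMatching G N → N ≐ᴱ M)

  IsUniquelyRestricted : BipartiteGraph a b → EdgeSet a b → Set₁
  IsUniquelyRestricted G M =
    IsUniquePerfectMatching (induced G (saturatedX G M) (saturatedY G M)) M

record Digraph (a : ℕ) : Set₁ where
  field
    V     : Subset a
    _⟶_   : Rel (Fin a) 0ℓ
    A⊆V×V : ∀ {u v} → u ⟶ v → u ∈ V × v ∈ V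

  order : ℕ
  order = ∣ V ∣

-- The cycle c₀ ⟶ c₁ ⟶ … ⟶ cₖ ⟶ c₀ on pairwise distinct vertices; k = 0 is a loop.
record DirectedCycle {a} (D : Digraph a) : Set where
  open Digraph D
  field
    k        : ℕ
    c        : Fin (suc k) → Fin a
    distinct : Injective _≡_ _≡_ c
    step     : ∀ (i : Fin k) → c (inject₁ i) ⟶ c (suc i)
    close    : c (fromℕ k) ⟶ c zero

Acyclic : ∀ {a} → Digraph a → Set
Acyclic D = ¬ DirectedCycle D

-- In an arc, y is the partner of x₂; it is unique when M is a matching.
BD : ∀ {a b} → BipartiteGraph a b → EdgeSet a b → Digraph a
BD G M = record
  { V     = V
  ; _⟶_   = λ x₁ x₂ → x₁ ∈ V × x₂ ∈ V ×
              ∃[ y ] M ∋ x₂ ─ y × E ∋ x₁ ─ y × ¬ (M ∋ x₁ ─ y)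
  ; A⊆V×V = λ { (x₁∈V , x₂∈V , _) → x₁∈V , x₂∈V }
  }
  where
  open BipartiteGraph G
  V = saturatedX G M

{-# OPTIONS --safe #-}

-- If D(G,M) has a directed cycle, rerouting every vertex of the cycle to the
-- partner of its successor yields a second perfect matching of the subgraph
-- induced by the M-saturated vertices.  Conversely, if N is a perfect matching
-- of that subgraph and x y ∈ N ∖ M, then the M-partner of y is a successor of
-- x in D(G,M) and again carries an edge of N ∖ M; following these arcs forever
-- revisits a vertex, which gives a cycle.  The order condition says that
-- 2 |saturatedX| = |X| + |Y|, and |saturatedX| = |saturatedY|, so it means
-- that every vertex is saturated.
module Submission where

open import Data.Fin using (Fin; zero; suc; toℕ; inject₁; fromℕ)
open import Data.Fin.Properties using (_≟_; any?; suc-injective; toℕ<n; toℕ-fromℕ; toℕ-inject₁; inject₁-injective; fromℕ≢inject₁; pigeonhole; <-cmp)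
open import Data.Fin.Relation.Unary.Top using (view; ‵fromℕ; ‵inject₁)
open import Data.Fin.Subset using (Subset; inside; outside; _∈_; _⊆_; _∩_; ∣_∣; _-_)
open import Data.Fin.Subset.Properties using (_∈?_; x∈p∩q⁺; x∈p∩q⁻; p⊆q⇒∣p∣≤∣q∣; p⊂q⇒∣p∣<∣q∣; x∈p∧x≢y⇒x∈p-y; x∈p⇒∣p-x∣<∣p∣; ⊆-antisym)
open import Data.Nat using (ℕ; suc; _+_; _*_; _∸_; _≤_; _<_; z≤n; s≤s; s≤s⁻¹)
open import Data.Nat.Induction using (<-rec)
open import Data.Nat.Properties using (+-assoc; +-identityʳ; +-suc; +-mono-<-≤; +-mono-≤-<; <-irrefl; ≤-antisym; ≤-trans; n<1+n; m≤n+m; m+[n∸m]≡n)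
open import Data.Product using (Σ; _×_; _,_; ∃-syntax; proj₁; proj₂)
open import Data.Sum using (_⊎_; inj₁; inj₂)
open import Data.Vec using ([]; _∷_; here; there)
open import Data.Vec.Properties using (lookup∘tabulate; lookup⇒[]=; []=⇒lookup)
open import Function using (_∘_; _⇔_; mk⇔; Equivalence)
open import Function.Definitions using (Injective)
open import Level using (0ℓ)
open import Relation.Binary using (tri<; tri≈; tri>)
open import Relation.Binary.PropositionalEquality using (_≡_; _≢_; refl; sym; trans; cong; cong₂; subst; subst₂)
open import Relation.Nullary using (¬_; does; yes; no; contradiction)
open import Relation.Nullary.Decidable using (_×-dec_; _⊎-dec_; ¬?; dec-true; decidable-stable)
import Data.Fin as Fin
import Relation.Unary as U
open import Defs

-- Subsets cut out by decidable predicates, and comparison of cardinalities.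

module _ {n} {P : U.Pred (Fin n) 0ℓ} (P? : U.Decidable P) where

  ∈-subset⁺ : ∀ {x} → P x → x ∈ subset P?
  ∈-subset⁺ {x} px =
    lookup⇒[]= x (subset P?) (trans (lookup∘tabulate (does ∘ P?) x) (dec-true (P? x) px))

  ∈-subset⁻ : ∀ {x} → x ∈ subset P? → P x
  ∈-subset⁻ {x} x∈ with P? x | trans (sym (lookup∘tabulate (does ∘ P?) x)) ([]=⇒lookup x∈)
  ... | yes px | _ = px
  ... | no _   | ()

-- Match the first element of `p` with some `y₀` and delete `y₀` from `q`; injectivity keeps the
-- later witnesses away from `y₀`. Using a relation lets a matching be read in both directions.
injectiveRelation⇒∣p∣≤∣q∣ : ∀ {a b} (p : Subset a) (q : Subset b) (R : Fin a → Fin b → Set) →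
  (∀ {x} → x ∈ p → ∃[ y ] y ∈ q × R x y) →
  (∀ {x x′ y} → R x y → R x′ y → x ≡ x′) → ∣ p ∣ ≤ ∣ q ∣
injectiveRelation⇒∣p∣≤∣q∣ [] q R total inj = z≤n
injectiveRelation⇒∣p∣≤∣q∣ (outside ∷ p) q R total inj =
  injectiveRelation⇒∣p∣≤∣q∣ p q (R ∘ suc) (total ∘ there) (λ r r′ → suc-injective (inj r r′))
injectiveRelation⇒∣p∣≤∣q∣ (inside ∷ p) q R total inj with total here
... | y₀ , y₀∈q , r₀ =
  ≤-trans (s≤s (injectiveRelation⇒∣p∣≤∣q∣ p (q - y₀) (R ∘ suc) total′ (λ r r′ → suc-injective (inj r r′))))
          (x∈p⇒∣p-x∣<∣p∣ y₀∈q)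
  where
  total′ : ∀ {x} → x ∈ p → ∃[ y ] y ∈ (q - y₀) × R (suc x) y
  total′ x∈p with total (there x∈p)
  ... | y , y∈q , r = y , x∈p∧x≢y⇒x∈p-y y∈q y≢y₀ , r
    where
    y≢y₀ : y ≢ y₀
    y≢y₀ refl with inj r r₀
    ... | ()

-- Cycles and walks in digraphs.

cyclicPred : ∀ {k} → Fin (suc k) → Fin (suc k)
cyclicPred zero    = fromℕ _
cyclicPred (suc i) = inject₁ i

cyclicPred-injective : ∀ {k} → Injective _≡_ _≡_ (cyclicPred {k})
cyclicPred-injective {_} {zero}  {zero}  _  = refl
cyclicPred-injective {_} {zero}  {suc j} eq = contradiction eq fromℕ≢inject₁
cyclicPred-injective {_} {suc i} {zero}  eq = contradiction (sym eq) fromℕ≢inject₁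
cyclicPred-injective {_} {suc i} {suc j} eq = cong suc (inject₁-injective eq)

cyclicPred-surjective : ∀ {k} (i : Fin (suc k)) → ∃[ j ] i ≡ cyclicPred j
cyclicPred-surjective i with view i
... | ‵fromℕ     = zero , refl
... | ‵inject₁ j = suc j , refl

module _ {a} (D : Digraph a) where
  open Digraph D

  -- Merges `step` and `close`, so that all arcs of the cycle are indexed uniformly by their heads.
  cyclicPred-arc : (C : DirectedCycle D) → let c = DirectedCycle.c C in
                   ∀ i → c (cyclicPred i) ⟶ c i
  cyclicPred-arc C zero    = DirectedCycle.close C
  cyclicPred-arc C (suc i) = DirectedCycle.step C i

  module _ (f : ℕ → Fin a) (walk : ∀ n → f n ⟶ f (suc n)) where

    -- A closed walk without a proper closed subwalk is a cycle.
    closedWalk⇒cycle : ∀ d i → f i ≡ f (i + suc d) → DirectedCycle D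
    closedWalk⇒cycle = <-rec _ shorten
      where
      shorten : ∀ d → (∀ {e} → e < d → ∀ i → f i ≡ f (i + suc e) → DirectedCycle D) →
                ∀ i → f i ≡ f (i + suc d) → DirectedCycle D
      shorten d rec i closed
        with any? (λ p → any? (λ q → (p Fin.<? q) ×-dec (g p ≟ g q)))
        where
        g : Fin (suc d) → Fin a
        g p = f (i + toℕ p)
      ... | yes (p , q , p<q , eq) = rec e<d (i + toℕ p) (trans eq (cong f q≡p+))
        where
        -- The closed subwalk between positions `p` and `q` has length `suc e`; it is shorter
        -- because `suc e` ≤ `toℕ q` ≤ `d`.
        e = toℕ q ∸ suc (toℕ p)
        p+e≡q : suc (toℕ p) + e ≡ toℕ q
        p+e≡q = m+[n∸m]≡n p<q
        q≡p+ : i + toℕ q ≡ i + toℕ p + suc e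
        q≡p+ = trans (cong (i +_) (sym (trans (+-suc (toℕ p) e) p+e≡q)))
                     (sym (+-assoc i (toℕ p) (suc e)))
        e<d : e < d
        e<d = ≤-trans (subst (suc e ≤_) p+e≡q (s≤s (m≤n+m e (toℕ p))))
                      (s≤s⁻¹ (toℕ<n q))
      ... | no noRepeat = record
        { k        = d
        ; c        = g
        ; distinct = distinct
        ; step     = λ j → subst₂ _⟶_ (cong (λ m → f (i + m)) (sym (toℕ-inject₁ j)))
                             (cong f (sym (+-suc i (toℕ j)))) (walk (i + toℕ j))
        -- The arc leaving position `i + d` ends at position `i + suc d`, which is `f i` again by
        -- `closed`.
        ; close    = subst₂ _⟶_ (cong (λ m → f (i + m)) (sym (toℕ-fromℕ d)))
                       (trans (cong f (sym (+-suc i d)))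
                         (trans (sym closed) (cong f (sym (+-identityʳ i)))))
                       (walk (i + d))
        }
        where
        g : Fin (suc d) → Fin a
        g p = f (i + toℕ p)
        distinct : Injective _≡_ _≡_ g
        distinct {p} {q} eq with <-cmp p q
        ... | tri< p<q _ _ = contradiction (p , q , p<q , eq) noRepeat
        ... | tri≈ _ p≡q _ = p≡q
        ... | tri> _ _ q<p = contradiction (q , p , q<p , sym eq) noRepeat

    infiniteWalk⇒cycle : DirectedCycle D
    infiniteWalk⇒cycle with pigeonhole (n<1+n a) (f ∘ toℕ)
    ... | i , j , i<j , eq =
      closedWalk⇒cycle (toℕ j ∸ suc (toℕ i)) (toℕ i)
        (trans eq (cong f (sym (trans (+-suc (toℕ i) _) (m+[n∸m]≡n i<j)))))

  -- Iterating `next` gives an infinite walk inside `B`. The walk carries the proof of `B` along,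
  -- since the next vertex may depend on it.
  noSinks⇒cycle : {B : Fin a → Set} → (∀ {u} → B u → ∃[ v ] u ⟶ v × B v) →
                  ∀ {u} → B u → DirectedCycle D
  noSinks⇒cycle {B} next {u} bu = infiniteWalk⇒cycle (proj₁ ∘ w) (λ n → proj₁ (proj₂ (next (proj₂ (w n)))))
    where
    w : ℕ → Σ (Fin a) B
    w 0       = u , bu
    w (suc n) = let (v , _ , bv) = next (proj₂ (w n)) in v , bv

-- Saturated vertices and the order condition.

module _ {a b} (G : BipartiteGraph a b) (M : EdgeSet a b) (isM : IsMatching G M) where
  open BipartiteGraph G
  open EdgeSet M using (_─?_)
  open IsMatching isM

  private
    SX = saturatedX G M
    SY = saturatedY G M
    H  = induced G SX SY
    D  = BD G M
  open Digraph D using (_⟶_)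

  ∈-saturatedX⁻ : ∀ {x} → x ∈ SX → x ∈ X × ∃[ y ] M ∋ x ─ y
  ∈-saturatedX⁻ = ∈-subset⁻ λ x → (x ∈? X) ×-dec any? λ y → x ─? y

  ∈-saturatedY⁻ : ∀ {y} → y ∈ SY → y ∈ Y × ∃[ x ] M ∋ x ─ y
  ∈-saturatedY⁻ = ∈-subset⁻ λ y → (y ∈? Y) ×-dec any? λ x → x ─? y

  edge⇒∈-saturatedX : ∀ {x y} → M ∋ x ─ y → x ∈ SX
  edge⇒∈-saturatedX m =
    ∈-subset⁺ (λ x → (x ∈? X) ×-dec any? λ y → x ─? y) (proj₁ (E⊆X×Y (M⊆E m)) , _ , m)

  edge⇒∈-saturatedY : ∀ {x y} → M ∋ x ─ y → y ∈ SY
  edge⇒∈-saturatedY m =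
    ∈-subset⁺ (λ y → (y ∈? Y) ×-dec any? λ x → x ─? y) (proj₂ (E⊆X×Y (M⊆E m)) , _ , m)

  saturatedX⊆X : SX ⊆ X
  saturatedX⊆X = proj₁ ∘ ∈-saturatedX⁻

  saturatedY⊆Y : SY ⊆ Y
  saturatedY⊆Y = proj₁ ∘ ∈-saturatedY⁻

  -- `M` is an injective relation in both directions, by `uniqueˣ` and by `uniqueʸ`.
  ∣saturatedX∣≡∣saturatedY∣ : ∣ SX ∣ ≡ ∣ SY ∣
  ∣saturatedX∣≡∣saturatedY∣ = ≤-antisym
    (injectiveRelation⇒∣p∣≤∣q∣ SX SY (M ∋_─_)
      (λ x∈ → let (_ , y , m) = ∈-saturatedX⁻ x∈ in y , edge⇒∈-saturatedY m , m) uniqueˣ)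
    (injectiveRelation⇒∣p∣≤∣q∣ SY SX (λ y x → M ∋ x ─ y)
      (λ y∈ → let (_ , x , m) = ∈-saturatedY⁻ y∈ in x , edge⇒∈-saturatedX m , m) uniqueʸ)

  2*∣saturatedX∣≡∣saturatedX∣+∣saturatedY∣ : 2 * ∣ SX ∣ ≡ ∣ SX ∣ + ∣ SY ∣
  2*∣saturatedX∣≡∣saturatedX∣+∣saturatedY∣ =
    cong (∣ SX ∣ +_) (trans (+-identityʳ ∣ SX ∣) ∣saturatedX∣≡∣saturatedY∣)

  perfect⇒order : IsPerfectMatching G M → 2 * ∣ SX ∣ ≡ order
  perfect⇒order perfect = trans 2*∣saturatedX∣≡∣saturatedX∣+∣saturatedY∣
    (cong₂ (λ p q → ∣ p ∣ + ∣ q ∣)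
      (⊆-antisym saturatedX⊆X (edge⇒∈-saturatedX ∘ proj₂ ∘ saturatesX))
      (⊆-antisym saturatedY⊆Y (edge⇒∈-saturatedY ∘ proj₂ ∘ saturatesY)))
    where
    open IsPerfectMatching perfect

  -- Since `SX ⊆ X` and `SY ⊆ Y`, a single unsaturated vertex on either side would make the sum of
  -- the cardinalities strictly smaller.
  order⇒perfect : 2 * ∣ SX ∣ ≡ order → IsPerfectMatching G M
  order⇒perfect eq = record
    { isMatching = isM
    ; saturatesX = λ x∈X → proj₂ (∈-saturatedX⁻ (X⊆SX x∈X))
    ; saturatesY = λ y∈Y → proj₂ (∈-saturatedY⁻ (Y⊆SY y∈Y))
    }
    where
    sum-eq : ∣ SX ∣ + ∣ SY ∣ ≡ ∣ X ∣ + ∣ Y ∣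
    sum-eq = trans (sym 2*∣saturatedX∣≡∣saturatedX∣+∣saturatedY∣) eq
    X⊆SX : X ⊆ SX
    X⊆SX {x} x∈X = decidable-stable (x ∈? SX) λ x∉SX →
      <-irrefl sum-eq (+-mono-<-≤ (p⊂q⇒∣p∣<∣q∣ (saturatedX⊆X , x , x∈X , x∉SX)) (p⊆q⇒∣p∣≤∣q∣ saturatedY⊆Y))
    Y⊆SY : Y ⊆ SY
    Y⊆SY {y} y∈Y = decidable-stable (y ∈? SY) λ y∉SY →
      <-irrefl sum-eq (+-mono-≤-< (p⊆q⇒∣p∣≤∣q∣ saturatedX⊆X) (p⊂q⇒∣p∣<∣q∣ (saturatedY⊆Y , y , y∈Y , y∉SY)))

  -- Holds for every matching, so being uniquely restricted reduces to uniqueness.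
  perfectOnSaturated : IsPerfectMatching H M
  perfectOnSaturated = record
    { isMatching = record
      { M⊆E     = λ m → M⊆E m , edge⇒∈-saturatedX m , edge⇒∈-saturatedY m
      ; uniqueʸ = uniqueʸ
      ; uniqueˣ = uniqueˣ
      }
    ; saturatesX = λ x∈ → proj₂ (∈-saturatedX⁻ (proj₂ (x∈p∩q⁻ X SX x∈)))
    ; saturatesY = λ y∈ → proj₂ (∈-saturatedY⁻ (proj₂ (x∈p∩q⁻ Y SY y∈)))
    }

  -- A second perfect matching from a directed cycle.

  module _ (C : DirectedCycle D) where
    open DirectedCycle C

    OnCycle : Fin a → Set
    OnCycle x = ∃[ i ] x ≡ c i

    onCycle? : U.Decidable OnCycle
    onCycle? x = any? λ i → x ≟ c i

    -- The symmetric difference of `M` with the alternating cycle of `G` that underlies `C`.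
    rerouted : EdgeSet a b
    rerouted = record
      { _─_  = λ x y → (¬ OnCycle x × M ∋ x ─ y) ⊎ (∃[ i ] x ≡ c (cyclicPred i) × M ∋ c i ─ y)
      ; _─?_ = λ x y → (¬? (onCycle? x) ×-dec (x ─? y)) ⊎-dec
                       any? λ i → (x ≟ c (cyclicPred i)) ×-dec (c i ─? y)
      }

    rerouted-perfect : IsPerfectMatching H rerouted
    rerouted-perfect = record
      { isMatching = record { M⊆E = N⊆E ; uniqueʸ = uniqueʸ′ ; uniqueˣ = uniqueˣ′ }
      ; saturatesX = saturatesX′
      ; saturatesY = saturatesY′
      }
      where
      N⊆E : rerouted ⊆ᴱ BipartiteGraph.E H
      N⊆E (inj₁ (_ , m)) = M⊆E m , edge⇒∈-saturatedX m , edge⇒∈-saturatedY m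
      N⊆E (inj₂ (i , refl , m)) with cyclicPred-arc D C i
      ... | u∈V , _ , y , m′ , e , _ =
        -- The arc names its own partner of `c i`, which `uniqueʸ` identifies with the given one.
        subst (E ∋ c (cyclicPred i) ─_) (uniqueʸ m′ m) e , u∈V , edge⇒∈-saturatedY m

      uniqueʸ′ : ∀ {x y y′} → rerouted ∋ x ─ y → rerouted ∋ x ─ y′ → y ≡ y′
      uniqueʸ′ (inj₁ (_ , m))        (inj₁ (_ , m′))        = uniqueʸ m m′
      uniqueʸ′ (inj₁ (off , _))      (inj₂ (i , eq , _))    = contradiction (_ , eq) off
      uniqueʸ′ (inj₂ (i , eq , _))   (inj₁ (off , _))       = contradiction (_ , eq) off
      uniqueʸ′ (inj₂ (i , refl , m)) (inj₂ (j , eq , m′))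
        with refl ← cyclicPred-injective {x = i} {j} (distinct eq) = uniqueʸ m m′

      uniqueˣ′ : ∀ {x x′ y} → rerouted ∋ x ─ y → rerouted ∋ x′ ─ y → x ≡ x′
      uniqueˣ′ (inj₁ (_ , m))        (inj₁ (_ , m′))        = uniqueˣ m m′
      uniqueˣ′ (inj₁ (off , m))      (inj₂ (i , _ , m′))    = contradiction (i , uniqueˣ m m′) off
      uniqueˣ′ (inj₂ (i , _ , m))    (inj₁ (off , m′))      = contradiction (i , uniqueˣ m′ m) off
      uniqueˣ′ (inj₂ (i , refl , m)) (inj₂ (j , refl , m′)) = cong (c ∘ cyclicPred) (distinct (uniqueˣ m m′))

      saturatesX′ : ∀ {x} → x ∈ X ∩ SX → ∃[ y ] rerouted ∋ x ─ y
      saturatesX′ {x} x∈ with onCycle? x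
      ... | no off = let (y , m) = IsPerfectMatching.saturatesX perfectOnSaturated x∈ in y , inj₁ (off , m)
      ... | yes (i , refl) with cyclicPred-surjective i
      ... | j , refl =
        -- `j` is the cyclic successor of the index of `x`, so `x` receives the partner of `c j`.
        let (_ , _ , y , m , _) = cyclicPred-arc D C j in y , inj₂ (j , refl , m)

      saturatesY′ : ∀ {y} → y ∈ Y ∩ SY → ∃[ x ] rerouted ∋ x ─ y
      saturatesY′ y∈ with IsPerfectMatching.saturatesY perfectOnSaturated y∈
      ... | x , m with onCycle? x
      ...   | no off         = x , inj₁ (off , m)
      ...   | yes (i , refl) = c (cyclicPred i) , inj₂ (i , refl , m)

    -- Every arc comes from an edge outside `M`, so the closing arc alone separates the two
    -- matchings.
    rerouted≢M : ¬ (rerouted ≐ᴱ M)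
    rerouted≢M same with cyclicPred-arc D C zero
    ... | _ , _ , y , m , _ , m∉ = m∉ (Equivalence.to (same _ y) (inj₂ (zero , refl , m)))

  -- Unique restriction versus acyclicity.

  uniquelyRestricted⇒acyclic : IsUniquelyRestricted G M → Acyclic D
  uniquelyRestricted⇒acyclic (_ , unique) C = rerouted≢M C (unique (rerouted C) (rerouted-perfect C))

  acyclic⇒uniquelyRestricted : Acyclic D → IsUniquelyRestricted G M
  acyclic⇒uniquelyRestricted acyclic = perfectOnSaturated , unique
    where
    unique : ∀ N → IsPerfectMatching H N → N ≐ᴱ M
    unique N perfect x y = mk⇔ N⊆M M⊆N
      where
      open IsPerfectMatching perfect
      module N = IsMatching isMatching

      Deviates : Fin a → Set
      Deviates u = ∃[ v ] N ∋ u ─ v × ¬ (M ∋ u ─ v)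

      next : ∀ {u} → Deviates u → ∃[ u′ ] u ⟶ u′ × Deviates u′
      next {u} (v , n , m∉) with N.M⊆E n
      ... | e , u∈SX , v∈SY with ∈-saturatedY⁻ v∈SY
      ... | _ , u′ , m with edge⇒∈-saturatedX m
      ... | u′∈SX with saturatesX (x∈p∩q⁺ (saturatedX⊆X u′∈SX , u′∈SX))
      ... | v′ , n′ = u′ , (u∈SX , u′∈SX , v , m , e , m∉) , v′ , n′ , m′∉
        where
        m′∉ : ¬ (M ∋ u′ ─ v′)
        -- If `u′` and `v′` were joined in `M`, then `v′` would be `v`; so `N` would join both `u`
        -- and `u′` to `v`, forcing `u′` to be `u` and contradicting `m∉`.
        m′∉ m′ with refl ← uniqueʸ m m′ with refl ← N.uniqueˣ n n′ = m∉ m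

      N⊆M : ∀ {x y} → N ∋ x ─ y → M ∋ x ─ y
      N⊆M {x} {y} n = decidable-stable (x ─? y) λ m∉ →
        acyclic (noSinks⇒cycle D next (y , n , m∉))

      M⊆N : M ∋ x ─ y → N ∋ x ─ y
      M⊆N m with edge⇒∈-saturatedX m
      ... | x∈SX with saturatesX (x∈p∩q⁺ (saturatedX⊆X x∈SX , x∈SX))
      -- The `N`-edge at `x` already lies in `M` by `N⊆M`, so it ends at the `M`-partner of `x`.
      ... | y′ , n with refl ← uniqueʸ m (N⊆M n) = n

theorem7 : ∀ {a b : ℕ} (G : BipartiteGraph a b) (M : EdgeSet a b) → IsMatching G M →
    (IsPerfectMatching G M × IsUniquelyRestricted G M) ⇔
    (Acyclic (BD G M) × 2 * Digraph.order (BD G M) ≡ BipartiteGraph.order G)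
theorem7 G M isM = mk⇔
  (λ (perfect , restricted) → uniquelyRestricted⇒acyclic G M isM restricted , perfect⇒order G M isM perfect)
  (λ (acyclic , eq) → order⇒perfect G M isM eq , acyclic⇒uniquelyRestricted G M isM acyclic)
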